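{- Let $G$ be a simple graph of order $n$ and let $\Delta$ be a non-negative integer. Then $G$ is (isomorphic to) a $\Delta$-regular graph if and only if $[x]\,da(G;x,y)=n\,y^{n-\Delta}$.
   Context: All graphs are finite, simple and have at least one vertex. For a graph $G$, $S\subseteq V(G)$ and $u\in V(G)$, let $\bar S=V(G)\setminus S$, let $\delta_S(u)=|\{v\in S:\{u,v\}\in E(G)\}|$, and let $G[S]$ be the subgraph induced by $S$. The defensive alliance polynomial of $G$ is $$da(G;x,y)=\sum_{S} x^{|S|}\,y^{f_y(S)},\qquad f_y(S)=\min_{u\in S}\bigl(\delta_S(u)-\delta_{\bar S}(u)+|V(G)|\bigr),$$ where the sum runs over all non-empty $S\subseteq V(G)$ such that $G[S]$ is connected (single-vertex graphs are connected). $[x^k]\,da(G;x,y)$ denotes the coefficient of $x^k$ in $da(G;x,y)$, which is a polynomial in $y$. -}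

module Defs where

open import Data.Fin.Base using (Fin)
open import Data.Fin.Permutation using (Permutation; _⟨$⟩ʳ_)
open import Data.Fin.Properties using (all?) renaming (_≟_ to _≟ᶠ_)
open import Data.Fin.Subset using (Subset; inside; outside; _∈_; _∩_; ∁; ∣_∣; Nonempty)
open import Data.Fin.Subset.Properties using (_∈?_; nonempty?)
open import Data.Integer.Base using (ℤ; +_; _+_; _-_; 0ℤ; 1ℤ)
open import Data.Integer.Properties using (≤-totalOrder) renaming (_≟_ to _≟ᶻ_)
open import Data.List.Base using (List; []; _∷_; _++_; [_]; map; concat; concatMap; filter; foldr; allFin)
import Data.List.Extrema as Extrema
open import Data.List.Membership.Propositional using () renaming (_∈_ to _∈ˡ_)
open import Data.List.Membership.Propositional.Properties using (∈-allFin)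
open import Data.List.Relation.Unary.Any using (here; there)
open import Data.Nat.Base using (ℕ; zero; suc)
open import Data.Nat.Properties using () renaming (_≟_ to _≟ⁿ_)
open import Data.Product.Base using (Σ-syntax; _×_; _,_; proj₁; proj₂)
open import Data.Sum.Base using (_⊎_; inj₁; inj₂)
open import Data.Vec.Base using (tabulate) renaming ([] to []ᵛ; _∷_ to _∷ᵛ_)
open import Function.Bundles using (_⇔_)
open import Level using (0ℓ)
open import Relation.Binary.Construct.Closure.ReflexiveTransitive using (Star; ε; _◅_; _◅◅_)
open import Relation.Binary.Core using (Rel)
open import Relation.Binary.Definitions using (Decidable; Irreflexive; Symmetric)
open import Relation.Binary.PropositionalEquality using (_≡_; refl)
open import Relation.Nullary.Decidable using (Dec; yes; no; does; map′; _×-dec_; _⊎-dec_; _→-dec_)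

record Graph (n : ℕ) : Set₁ where
  field
    Adj    : Rel (Fin n) 0ℓ
    adj?   : Decidable Adj
    sym    : Symmetric Adj
    irrefl : Irreflexive _≡_ Adj

  neighbours : Fin n → Subset n
  neighbours u = tabulate (λ v → does (adj? u v))

  degree : Fin n → ℕ
  degree u = ∣ neighbours u ∣

  δ : Subset n → Fin n → ℕ
  δ S u = ∣ S ∩ neighbours u ∣

  InducedAdj : Subset n → Rel (Fin n) 0ℓ
  InducedAdj S u v = u ∈ S × v ∈ S × Adj u v

  InducedConnected : Subset n → Set
  InducedConnected S = ∀ u v → u ∈ S → v ∈ S → Star (InducedAdj S) u v

open Graph

Regular : ∀ {n} → ℕ → Graph n → Set
Regular Δ G = ∀ u → degree G u ≡ Δ

_≅_ : ∀ {m n} → Graph m → Graph n → Set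
_≅_ {m} {n} G H =
  Σ[ π ∈ Permutation m n ] (∀ u v → Adj G u v ⇔ Adj H (π ⟨$⟩ʳ u) (π ⟨$⟩ʳ v))

-- Reachability along a decidable relation on a finite set is decidable
-- (Warshall's algorithm).
module _ {n : ℕ} {R : Rel (Fin n) 0ℓ} (R? : Decidable R) where

  private
    -- Reachability with all intermediate vertices taken from the list.
    Via : List (Fin n) → Rel (Fin n) 0ℓ
    Via []       u v = u ≡ v ⊎ R u v
    Via (w ∷ ws) u v = Via ws u v ⊎ (Via ws u w × Via ws w v)

    via? : ∀ ws → Decidable (Via ws)
    via? []       u v = (u ≟ᶠ v) ⊎-dec R? u v
    via? (w ∷ ws) u v = via? ws u v ⊎-dec (via? ws u w ×-dec via? ws w v)

    via⇒star : ∀ ws {u v} → Via ws u v → Star R u v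
    via⇒star []       (inj₁ refl)    = ε
    via⇒star []       (inj₂ r)       = r ◅ ε
    via⇒star (w ∷ ws) (inj₁ p)       = via⇒star ws p
    via⇒star (w ∷ ws) (inj₂ (p , q)) = via⇒star ws p ◅◅ via⇒star ws q

    base : ∀ ws {u v} → u ≡ v ⊎ R u v → Via ws u v
    base []       p = p
    base (w ∷ ws) p = inj₁ (base ws p)

    to-head : ∀ {w ws u} → Via (w ∷ ws) u w → Via ws u w
    to-head (inj₁ p)       = p
    to-head (inj₂ (p , _)) = p

    from-head : ∀ {w ws v} → Via (w ∷ ws) w v → Via ws w v
    from-head (inj₁ p)       = p
    from-head (inj₂ (_ , q)) = q

    via-trans : ∀ {ws u m v} → m ∈ˡ ws → Via ws u m → Via ws m v → Via ws u v
    via-trans (here refl) p q = inj₂ (to-head p , from-head q)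
    via-trans (there m∈)  (inj₁ p)       (inj₁ q)        = inj₁ (via-trans m∈ p q)
    via-trans (there m∈)  (inj₁ p)       (inj₂ (q , q′)) = inj₂ (via-trans m∈ p q , q′)
    via-trans (there m∈)  (inj₂ (p , p′)) (inj₁ q)       = inj₂ (p , via-trans m∈ p′ q)
    via-trans (there m∈)  (inj₂ (p , _)) (inj₂ (_ , q′)) = inj₂ (p , q′)

    star⇒via : ∀ {u v} → Star R u v → Via (allFin n) u v
    star⇒via ε        = base (allFin n) (inj₁ refl)
    star⇒via (r ◅ rs) =
      via-trans (∈-allFin _) (base (allFin n) (inj₂ r)) (star⇒via rs)

  star? : Decidable (Star R)
  star? u v = map′ (via⇒star (allFin n)) star⇒via (via? (allFin n) u v)

inducedAdj? : ∀ {n} (G : Graph n) (S : Subset n) → Decidable (InducedAdj G S)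
inducedAdj? G S u v = (u ∈? S) ×-dec ((v ∈? S) ×-dec adj? G u v)

inducedConnected? : ∀ {n} (G : Graph n) (S : Subset n) → Dec (InducedConnected G S)
inducedConnected? G S = all? λ u → all? λ v →
  (u ∈? S) →-dec ((v ∈? S) →-dec star? (inducedAdj? G S) u v)

-- Finite formal sums of terms; a pair (c , e) stands for c y^e.  Integer
-- exponents are allowed so that y^(n - Δ) makes sense also when Δ > n.
Laurent : Set
Laurent = List (ℤ × ℤ)

infix 8 _·y^_
_·y^_ : ℤ → ℤ → Laurent
c ·y^ e = [ (c , e) ]

coeff : ℤ → Laurent → ℤ
coeff e p = foldr _+_ 0ℤ (map proj₁ (filter (λ t → proj₂ t ≟ᶻ e) p))

-- Lists of terms denote the same polynomial when like terms collect to the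
-- same coefficients.
infix 4 _≈_
_≈_ : Rel Laurent 0ℓ
p ≈ q = ∀ e → coeff e p ≡ coeff e q

-- Polynomials in x over Laurent; a pair (k , p) stands for x^k p(y).
Poly : Set
Poly = List (ℕ × Laurent)

infix 8 [x^_]_
[x^_]_ : ℕ → Poly → Laurent
[x^ k ] P = concat (map proj₂ (filter (λ t → proj₁ t ≟ⁿ k) P))

subsets : ∀ n → List (Subset n)
subsets zero    = [ []ᵛ ]
subsets (suc n) = map (outside ∷ᵛ_) (subsets n) ++ map (inside ∷ᵛ_) (subsets n)

module _ {n : ℕ} (G : Graph n) where

  excess : Subset n → Fin n → ℤ
  excess S u = + δ G S u - + δ G (∁ S) u + + n

  -- `min` takes an initial value; the one given here is already attained
  -- on S, so the result is the minimum over S.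
  f-y : (S : Subset n) → Nonempty S → ℤ
  f-y S (u , _) =
    Extrema.min ≤-totalOrder (excess S u) (map (excess S) (filter (_∈? S) (allFin n)))

  term : Subset n → Poly
  term S with nonempty? S ×-dec inducedConnected? G S
  ... | yes (S≢∅ , _) = [ (∣ S ∣ , 1ℤ ·y^ f-y S S≢∅) ]
  ... | no  _         = []

  da : Poly
  da = concatMap term (subsets n)

{-# OPTIONS --safe #-}
-- The coefficient of x collects the terms of the singletons {u}, whose exponent
-- is n − deg u. Being a sum of n monomials with coefficient 1, it equals
-- n y^(n−Δ) exactly when every exponent is n − Δ: the coefficient of
-- y^(n − deg u) is positive, so that exponent must be the one on the right.
module Submission where

open import Defs
import Algebra.Properties.AbelianGroup
import Algebra.Properties.CommutativeMonoid.Sum as Sum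
open import Data.Bool.Base using (if_then_else_)
open import Data.Fin.Base using (Fin; zero; suc)
open import Data.Fin.Permutation using (_⟨$⟩ʳ_) renaming (id to idᵖ)
open import Data.Fin.Subset using (Subset; inside; outside; _∈_; _∉_; _∩_; ∁; ∣_∣; Nonempty; ⊥; ⁅_⁆)
open import Data.Fin.Subset.Properties using
  (_∈?_; nonempty?; Empty-unique; ⊆-antisym; p∩q⊆q; x∈p∩q⁻; x∈p∩q⁺; x∉p⇒x∈∁p; x∈⁅x⁆; x∈⁅y⁆⇒x≡y; ∣⁅x⁆∣≡1; ∣⊥∣≡0)
open import Data.Integer.Base as ℤ using (ℤ; +_; _-_; _+_; -_; 0ℤ; 1ℤ; +≤+; +<+)
import Data.Integer.Properties as ℤ
open import Data.List.Base using (List; []; _∷_; _++_; map; concat; concatMap; filter; allFin)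
import Data.List.Extrema as Extrema
open import Data.List.Properties using (++-identityʳ; filter-++; filter-reject; concatMap-++; concatMap-map)
import Data.List.Relation.Unary.All as All
open import Data.List.Relation.Unary.All.Properties using (all-filter; map⁺)
open import Data.Nat.Base as ℕ using (ℕ; zero; suc; NonZero; z≤n; s≤s)
import Data.Nat.Properties as ℕ
open import Data.Product.Base using (Σ-syntax; _×_; _,_; proj₁; proj₂)
open import Data.Vec.Base using (tabulate) renaming (_∷_ to _∷ᵛ_)
open import Data.Vec.Properties using ([]=⇒lookup; lookup∘tabulate)
open import Function.Base using (_∘_)
open import Function.Bundles using (_⇔_; mk⇔)
open import Function.Construct.Identity using (⇔-id)
open import Relation.Binary.Construct.Closure.ReflexiveTransitive using (ε)
open import Relation.Binary.PropositionalEquality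
  using (_≡_; _≢_; refl; sym; trans; cong; cong₂; subst; module ≡-Reasoning)
open import Relation.Nullary.Decidable using (yes; no; does; does-⇔; dec-false; _×-dec_)
open import Relation.Nullary.Negation using (contradiction)

open Graph using (Adj; adj?; irrefl; neighbours; degree; δ; InducedConnected)

open Algebra.Properties.AbelianGroup ℤ.+-0-abelianGroup using (∙-cancelˡ)
open Sum ℤ.+-0-commutativeMonoid using (sum; sum-syntax; sum-cong-≗)
module ℕSum = Sum ℕ.+-0-commutativeMonoid

-- Coefficients of formal sums in y

coeff-++ : ∀ e p q → coeff e (p ++ q) ≡ coeff e p + coeff e q
coeff-++ e []            q = sym (ℤ.+-identityˡ _)
coeff-++ e ((c , f) ∷ p) q with f ℤ.≟ e
... | yes _ = trans (cong (ℤ._+_ c) (coeff-++ e p q)) (sym (ℤ.+-assoc c _ _))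
... | no  _ = coeff-++ e p q

coeff-monomial-≡ : ∀ c e → coeff e (c ·y^ e) ≡ c
coeff-monomial-≡ c e with e ℤ.≟ e
... | yes _   = ℤ.+-identityʳ c
... | no  e≢e = contradiction refl e≢e

coeff-monomial-≢ : ∀ c {e f} → f ≢ e → coeff e (c ·y^ f) ≡ 0ℤ
coeff-monomial-≢ c {e} {f} f≢e with f ℤ.≟ e
... | yes f≡e = contradiction f≡e f≢e
... | no  _   = refl

-- Splits `n y^f` into `n` unit monomials, so that it can be compared summand by summand with a sum
-- over the vertices.
coeff-monomial-sum : ∀ n e f → coeff e ((+ n) ·y^ f) ≡ ∑[ i < n ] coeff e (1ℤ ·y^ f)
coeff-monomial-sum zero e f with f ℤ.≟ e
... | yes _ = refl
... | no  _ = refl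
coeff-monomial-sum (suc n) e f = trans split (cong (ℤ._+_ (coeff e (1ℤ ·y^ f))) (coeff-monomial-sum n e f))
  where
  split : coeff e ((+ suc n) ·y^ f) ≡ coeff e (1ℤ ·y^ f) + coeff e ((+ n) ·y^ f)
  split with f ℤ.≟ e
  ... | yes _ = refl
  ... | no  _ = refl

0≤coeff-unit : ∀ e f → 0ℤ ℤ.≤ coeff e (1ℤ ·y^ f)
0≤coeff-unit e f with f ℤ.≟ e
... | yes _ = +≤+ z≤n
... | no  _ = +≤+ z≤n

sum-nonneg : ∀ {n} (t : Fin n → ℤ) → (∀ i → 0ℤ ℤ.≤ t i) → 0ℤ ℤ.≤ sum t
sum-nonneg {zero}  t t≥0 = ℤ.≤-refl
sum-nonneg {suc n} t t≥0 = ℤ.+-mono-≤ (t≥0 zero) (sum-nonneg (t ∘ suc) (t≥0 ∘ suc))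

-- Non-negative summands cannot cancel, so a single positive one fixes the sign of the total.
sum-pos : ∀ {n} (t : Fin n → ℤ) → (∀ i → 0ℤ ℤ.≤ t i) → ∀ i → 0ℤ ℤ.< t i → 0ℤ ℤ.< sum t
sum-pos t t≥0 zero    tᵢ>0 = ℤ.+-mono-<-≤ tᵢ>0 (sum-nonneg (t ∘ suc) (t≥0 ∘ suc))
sum-pos t t≥0 (suc i) tᵢ>0 = ℤ.+-mono-≤-< (t≥0 zero) (sum-pos (t ∘ suc) (t≥0 ∘ suc) i tᵢ>0)

-- Extraction of a power of x

[x^]-++ : ∀ k P Q → [x^ k ] (P ++ Q) ≡ [x^ k ] P ++ [x^ k ] Q
[x^]-++ k P Q = begin
  [x^ k ] (P ++ Q)                               ≡⟨ cong (concat ∘ map proj₂) (filter-++ ≟k P Q) ⟩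
  concatMap proj₂ (filter ≟k P ++ filter ≟k Q)   ≡⟨ concatMap-++ proj₂ (filter ≟k P) _ ⟩
  [x^ k ] P ++ [x^ k ] Q                         ∎
  where
  open ≡-Reasoning
  ≟k = λ (t : ℕ × Laurent) → proj₁ t ℕ.≟ k

[x^]-concatMap : ∀ {A : Set} k (f : A → Poly) xs →
  [x^ k ] (concatMap f xs) ≡ concatMap (λ x → [x^ k ] (f x)) xs
[x^]-concatMap k f []       = refl
[x^]-concatMap k f (x ∷ xs) =
  trans ([x^]-++ k (f x) _) (cong ([x^ k ] (f x) ++_) ([x^]-concatMap k f xs))

concatMap-[] : ∀ {A B : Set} (f : A → List B) → (∀ x → f x ≡ []) → ∀ xs → concatMap f xs ≡ []
concatMap-[] f f≡[] []       = refl
concatMap-[] f f≡[] (x ∷ xs) = cong₂ _++_ (f≡[] x) (concatMap-[] f f≡[] xs)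

-- Collecting terms over all subsets

concatMap-subsets-suc : ∀ {B : Set} n (f : Subset (suc n) → List B) →
  concatMap f (subsets (suc n)) ≡
    concatMap (f ∘ (outside ∷ᵛ_)) (subsets n) ++ concatMap (f ∘ (inside ∷ᵛ_)) (subsets n)
concatMap-subsets-suc n f = trans
  (concatMap-++ f (map (outside ∷ᵛ_) (subsets n)) _)
  (cong₂ _++_ (concatMap-map f _ (subsets n)) (concatMap-map f _ (subsets n)))

-- Serves the sets that contain a fixed vertex: such a set is a singleton exactly when the rest of
-- it is empty.
concatMap-empty : ∀ {B : Set} n (f : Subset n → List B) → (∀ S → ∣ S ∣ ≢ 0 → f S ≡ []) →
  concatMap f (subsets n) ≡ f ⊥
concatMap-empty zero    f _    = ++-identityʳ _
concatMap-empty (suc n) f f≡[] = begin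
  concatMap f (subsets (suc n)) ≡⟨ concatMap-subsets-suc n f ⟩
  concatMap (f ∘ (outside ∷ᵛ_)) (subsets n) ++ concatMap (f ∘ (inside ∷ᵛ_)) (subsets n)
    ≡⟨ cong₂ _++_ (concatMap-empty n _ (f≡[] ∘ (outside ∷ᵛ_)))
                  (concatMap-[] _ (λ S → f≡[] (inside ∷ᵛ S) λ ()) (subsets n)) ⟩
  f ⊥ ++ []                     ≡⟨ ++-identityʳ _ ⟩
  f ⊥                           ∎
  where open ≡-Reasoning

-- Induction on `n`, splitting the subsets by whether they contain vertex zero. Those that do
-- contribute only through `⁅ zero ⁆`; the others are subsets of the remaining vertices.
coeff-singletons : ∀ e n (f : Subset n → Laurent) → (∀ S → ∣ S ∣ ≢ 1 → f S ≡ []) →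
  coeff e (concatMap f (subsets n)) ≡ ∑[ u < n ] coeff e (f ⁅ u ⁆)
coeff-singletons e zero    f f≡[] = cong (λ p → coeff e (p ++ [])) (f≡[] _ λ ())
coeff-singletons e (suc n) f f≡[] = begin
  coeff e (concatMap f (subsets (suc n)))
    ≡⟨ cong (coeff e) (concatMap-subsets-suc n f) ⟩
  coeff e (outer ++ inner)
    ≡⟨ coeff-++ e outer inner ⟩
  coeff e outer + coeff e inner
    -- `subsets` lists the sets without vertex zero first, whereas the sum over `Fin` starts at
    -- zero. The two orders agree only after taking coefficients.
    ≡⟨ ℤ.+-comm (coeff e outer) _ ⟩
  coeff e inner + coeff e outer
    ≡⟨ cong₂ _+_ (cong (coeff e) (concatMap-empty n _ (λ S S≢ → f≡[] (inside ∷ᵛ S) (S≢ ∘ ℕ.suc-injective))))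
                 (coeff-singletons e n _ (f≡[] ∘ (outside ∷ᵛ_))) ⟩
  coeff e (f ⁅ zero ⁆) + ∑[ u < n ] coeff e (f ⁅ suc u ⁆) ∎
  where
  open ≡-Reasoning
  outer = concatMap (f ∘ (outside ∷ᵛ_)) (subsets n)
  inner = concatMap (f ∘ (inside ∷ᵛ_)) (subsets n)

-- Degrees under isomorphism

∣tabulate∣ : ∀ {n} (f : Fin n → _) → ∣ tabulate f ∣ ≡ ℕSum.sum (λ i → if f i then 1 else 0)
∣tabulate∣ {zero}  f = refl
∣tabulate∣ {suc n} f with f zero
... | outside = ∣tabulate∣ (f ∘ suc)
... | inside  = cong suc (∣tabulate∣ (f ∘ suc))

-- Written as a sum of 0/1 indicators of adjacency, a degree can be reindexed along the permutation,
-- under which the indicators agree.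
degree-≅ : ∀ {m n} {G : Graph m} {H : Graph n} ((π , _) : G ≅ H) → ∀ u →
  degree G u ≡ degree H (π ⟨$⟩ʳ u)
degree-≅ {m} {n} {G} {H} (π , adj⇔) u = begin
  degree G u                  ≡⟨ ∣tabulate∣ {m} _ ⟩
  ℕSum.sum (λ v → if does (adj? G u v) then 1 else 0)
    ≡⟨ ℕSum.sum-cong-≗ (λ v → cong (if_then 1 else 0)
         (does-⇔ (adj⇔ u v) (adj? G u v) (adj? H (π ⟨$⟩ʳ u) (π ⟨$⟩ʳ v)))) ⟩
  ℕSum.sum (λ v → if does (adj? H (π ⟨$⟩ʳ u) (π ⟨$⟩ʳ v)) then 1 else 0)
    ≡⟨ ℕSum.sum-permute (λ w → if does (adj? H (π ⟨$⟩ʳ u) w) then 1 else 0) π ⟨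
  ℕSum.sum (λ w → if does (adj? H (π ⟨$⟩ʳ u) w) then 1 else 0)
    ≡⟨ ∣tabulate∣ {n} _ ⟨
  degree H (π ⟨$⟩ʳ u)         ∎
  where open ≡-Reasoning

-- The term of a singleton

x∉p⇒⁅x⁆∩p≡⊥ : ∀ {n} {x : Fin n} {p} → x ∉ p → ⁅ x ⁆ ∩ p ≡ ⊥
x∉p⇒⁅x⁆∩p≡⊥ {x = x} {p} x∉p = Empty-unique λ (y , y∈) →
  let y∈⁅x⁆ , y∈p = x∈p∩q⁻ ⁅ x ⁆ p y∈ in
  x∉p (subst (_∈ p) (x∈⁅y⁆⇒x≡y x y∈⁅x⁆) y∈p)

x∉p⇒∁⁅x⁆∩p≡p : ∀ {n} {x : Fin n} {p} → x ∉ p → ∁ ⁅ x ⁆ ∩ p ≡ p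
x∉p⇒∁⁅x⁆∩p≡p {x = x} {p} x∉p = ⊆-antisym (p∩q⊆q (∁ ⁅ x ⁆) p) λ {y} y∈p →
  x∈p∩q⁺ (x∉p⇒x∈∁p (λ y∈⁅x⁆ → x∉p (subst (_∈ p) (x∈⁅y⁆⇒x≡y x y∈⁅x⁆) y∈p)) , y∈p)

module _ {n} (G : Graph n) where

  u∉neighbours : ∀ u → u ∉ neighbours G u
  u∉neighbours u u∈ = contradiction
    (trans (sym (dec-false (adj? G u u) (irrefl G refl)))
           (trans (sym (lookup∘tabulate _ u)) ([]=⇒lookup u∈)))
    λ ()

  -- By irreflexivity no neighbour of `u` lies in `⁅ u ⁆`, so all of them lie in the complement: the
  -- two counts are 0 and the degree.
  excess-singleton : ∀ u → excess G ⁅ u ⁆ u ≡ + n - + degree G u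
  excess-singleton u = begin
    + δ G ⁅ u ⁆ u - + δ G (∁ ⁅ u ⁆) u + + n
      ≡⟨ cong₂ (λ a b → + a - + b + + n)
           (trans (cong ∣_∣ (x∉p⇒⁅x⁆∩p≡⊥ (u∉neighbours u))) (∣⊥∣≡0 n))
           (cong ∣_∣ (x∉p⇒∁⁅x⁆∩p≡p (u∉neighbours u))) ⟩
    0ℤ - + degree G u + + n   ≡⟨ cong (_+ + n) (ℤ.+-identityˡ (- + degree G u)) ⟩
    - + degree G u + + n      ≡⟨ ℤ.+-comm (- + degree G u) (+ n) ⟩
    + n - + degree G u        ∎
    where open ≡-Reasoning

  f-y-singleton : ∀ u (ne : Nonempty ⁅ u ⁆) → f-y G ⁅ u ⁆ ne ≡ excess G ⁅ u ⁆ u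
  -- The witness `v` supplies the initial value of the minimum. Once it is identified with `u`, that
  -- value is an upper bound; it is also a lower bound, since every listed vertex is `u`.
  f-y-singleton u (v , v∈) with refl ← x∈⁅y⁆⇒x≡y u v∈ = ℤ.≤-antisym
    (min≤⊤ _ values)
    (v≤min⁺ {xs = values} ℤ.≤-refl (map⁺ (All.map
      (λ w∈ → ℤ.≤-reflexive (cong (excess G ⁅ u ⁆) (sym (x∈⁅y⁆⇒x≡y u w∈))))
      (all-filter (_∈? ⁅ u ⁆) (allFin n)))))
    where
    open Extrema ℤ.≤-totalOrder
    values = map (excess G ⁅ u ⁆) (filter (_∈? ⁅ u ⁆) (allFin n))

  singleton-connected : ∀ u → InducedConnected G ⁅ u ⁆
  singleton-connected u v w v∈ w∈
    rewrite x∈⁅y⁆⇒x≡y u v∈ | x∈⁅y⁆⇒x≡y u w∈ = ε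

  [x]term-singleton : ∀ u → [x^ 1 ] (term G ⁅ u ⁆) ≡ 1ℤ ·y^ (+ n - + degree G u)
  [x]term-singleton u with nonempty? ⁅ u ⁆ ×-dec inducedConnected? G ⁅ u ⁆
  ... | no ¬p = contradiction ((u , x∈⁅x⁆ u) , singleton-connected u) ¬p
  -- With the size rewritten to 1, the filter inside `[x^ 1 ]` computes and keeps the term.
  ... | yes (ne , _) rewrite ∣⁅x⁆∣≡1 u =
    cong (1ℤ ·y^_) (trans (f-y-singleton u ne) (excess-singleton u))

  [x^k]term : ∀ k S → ∣ S ∣ ≢ k → [x^ k ] (term G S) ≡ []
  [x^k]term k S S≢k with nonempty? S ×-dec inducedConnected? G S
  ... | no  _ = refl
  ... | yes _ = cong (concat ∘ map proj₂) (filter-reject (λ t → proj₁ t ℕ.≟ k) S≢k)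

  -- The coefficient of x and regularity

  coeff-[x]da : ∀ e →
    coeff e ([x^ 1 ] (da G)) ≡ ∑[ u < n ] coeff e (1ℤ ·y^ (+ n - + degree G u))
  coeff-[x]da e = begin
    coeff e ([x^ 1 ] (da G))
      ≡⟨ cong (coeff e) ([x^]-concatMap 1 (term G) (subsets n)) ⟩
    coeff e (concatMap (λ S → [x^ 1 ] (term G S)) (subsets n))
      ≡⟨ coeff-singletons e n _ ([x^k]term 1) ⟩
    ∑[ u < n ] coeff e ([x^ 1 ] (term G ⁅ u ⁆))
      ≡⟨ sum-cong-≗ (λ u → cong (coeff e) ([x]term-singleton u)) ⟩
    ∑[ u < n ] coeff e (1ℤ ·y^ (+ n - + degree G u)) ∎
    where open ≡-Reasoning

  Regular⇒[x]da : ∀ Δ → Regular Δ G → [x^ 1 ] (da G) ≈ (+ n) ·y^ (+ n - + Δ)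
  Regular⇒[x]da Δ reg e = begin
    coeff e ([x^ 1 ] (da G))                         ≡⟨ coeff-[x]da e ⟩
    ∑[ u < n ] coeff e (1ℤ ·y^ (+ n - + degree G u))
      ≡⟨ sum-cong-≗ (λ u → cong (λ d → coeff e (1ℤ ·y^ (+ n - + d))) (reg u)) ⟩
    ∑[ u < n ] coeff e (1ℤ ·y^ (+ n - + Δ))          ≡⟨ coeff-monomial-sum n e (+ n - + Δ) ⟨
    coeff e ((+ n) ·y^ (+ n - + Δ))                  ∎
    where open ≡-Reasoning

  [x]da⇒Regular : ∀ Δ → [x^ 1 ] (da G) ≈ (+ n) ·y^ (+ n - + Δ) → Regular Δ G
  [x]da⇒Regular Δ eq u with + n - + Δ ℤ.≟ + n - + degree G u
  ... | yes n-Δ≡n-d = sym (ℤ.+-injective (ℤ.neg-injective (∙-cancelˡ (+ n) _ _ n-Δ≡n-d)))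
  ... | no  n-Δ≢n-d = contradiction (sym (begin
    coeff e ([x^ 1 ] (da G))         ≡⟨ eq e ⟩
    coeff e ((+ n) ·y^ (+ n - + Δ))  ≡⟨ coeff-monomial-≢ (+ n) n-Δ≢n-d ⟩
    0ℤ                               ∎)) (ℤ.<⇒≢ pos)
    where
    open ≡-Reasoning
    e = + n - + degree G u
    pos : 0ℤ ℤ.< coeff e ([x^ 1 ] (da G))
    -- The summand of `u` itself is 1, because its exponent is `e`; all the others are at least 0.
    pos = subst (0ℤ ℤ.<_) (sym (coeff-[x]da e))
      (sum-pos _ (λ v → 0≤coeff-unit e (+ n - + degree G v)) u
        (subst (0ℤ ℤ.<_) (sym (coeff-monomial-≡ 1ℤ e)) (+<+ (s≤s z≤n))))

proposition21 : ∀ (n : ℕ) .{{_ : NonZero n}} (G : Graph n) (Δ : ℕ) →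
    (Σ[ m ∈ ℕ ] Σ[ H ∈ Graph m ] (G ≅ H × Regular Δ H)) ⇔
    ([x^ 1 ] (da G) ≈ (+ n) ·y^ (+ n - + Δ))
proposition21 n G Δ = mk⇔
  -- Regularity is pulled back from `H` to `G` first, as the polynomial is that of `G`.
  (λ (m , H , iso@(π , _) , reg) →
    Regular⇒[x]da G Δ (λ u → trans (degree-≅ {G = G} {H = H} iso u) (reg (π ⟨$⟩ʳ u))))
  -- `G` itself, with the identity permutation, is the required regular graph.
  (λ eq → n , G , (idᵖ , λ u v → ⇔-id (Adj G u v)) , [x]da⇒Regular G Δ eq)
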